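{- There is an absolute constant $C>0$ such that for every prime $p$ there exists a Latin trade $T$ in $B_p$ with $|T|\le C\log p$ such that every symbol of $\mathbb{Z}_p$ occurs in $T$ either exactly twice or not at all.
   Context: A Latin square of order $p$ is viewed as a set of (row, column, symbol) triples in $\mathbb{Z}_p^3$. $B_p$ is the addition table of $\mathbb{Z}_p$: the Latin square with symbol $i+j \pmod p$ in cell $(i,j)$, $i,j\in\mathbb{Z}_p$. A Latin trade in a Latin square $L$ is a subset $T\subseteq L$ for which there is a partial Latin square $T'$ (a disjoint mate) such that $T$ and $T'$ occupy the same set of cells, $T\cap T'=\emptyset$, and each row (respectively column) of $T$ contains the same set of symbols as the corresponding row (column) of $T'$. $|T|$ is the number of triples in $T$. -}

module Defs where

open import Data.Nat as ℕ using (ℕ; suc; _≤_; _^_; _∸_; NonZero)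
import Data.Nat.Properties as ℕₚ
open import Data.Nat.DivMod
  using (_%_; _mod_; m%n<n; m<n⇒m%n≡m; [m+n]%n≡m%n; m%n%n≡m%n; %-distribˡ-+)
open import Data.Fin using (Fin; toℕ; _≟_)
open import Data.Fin.Properties using (toℕ-fromℕ<; toℕ-injective; toℕ<n; toℕ≤n)
open import Data.List using (List; length; filter)
open import Data.List.Membership.Propositional using () renaming (_∈_ to _∈ˡ_)
open import Data.List.Relation.Unary.Unique.Propositional using (Unique)
open import Data.Product using (_×_; _,_; ∃-syntax)
open import Function.Bundles using (_⇔_)
open import Function.Definitions using (Injective; Bijective)
open import Relation.Nullary using (¬_)
open import Relation.Binary.PropositionalEquality
  using (_≡_; refl; trans; cong; module ≡-Reasoning)

-- Z_p is carried by Fin p.  Matching on the order lets ⊕ be used for every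
-- p without a NonZero argument (Fin 0 has no elements).
infixl 6 _⊕_
_⊕_ : ∀ {p} → Fin p → Fin p → Fin p
_⊕_ {suc k} i j = (toℕ i ℕ.+ toℕ j) mod suc k

-- (row , column , symbol)
Triple : ℕ → Set
Triple n = Fin n × Fin n × Fin n

symbol : ∀ {n} → Triple n → Fin n
symbol (_ , _ , s) = s

-- Subsets of Fin n × Fin n × Fin n; the absence of repetitions makes the
-- length of the list the cardinality of the set.
record TripleSet (n : ℕ) : Set where
  field
    elements : List (Triple n)
    unique   : Unique elements

open TripleSet public

infix 4 _∈_
_∈_ : ∀ {n} → Triple n → TripleSet n → Set
t ∈ T = t ∈ˡ elements T

∣_∣ : ∀ {n} → TripleSet n → ℕ
∣ T ∣ = length (elements T)

-- Needed as a separate condition: the empty set satisfies IsLatinTrade below.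
Nonempty : ∀ {n} → TripleSet n → Set
Nonempty T = ∃[ t ] t ∈ T

occurrences : ∀ {n} → Fin n → TripleSet n → ℕ
occurrences s T = length (filter (λ t → symbol t ≟ s) (elements T))

record IsPartialLatinSquare {n : ℕ} (P : TripleSet n) : Set where
  field
    cell   : ∀ {r c s s′} → (r , c , s) ∈ P → (r , c , s′) ∈ P → s ≡ s′
    row    : ∀ {r c c′ s} → (r , c , s) ∈ P → (r , c′ , s) ∈ P → c ≡ c′
    column : ∀ {r r′ c s} → (r , c , s) ∈ P → (r′ , c , s) ∈ P → r ≡ r′

record LatinSquare (n : ℕ) : Set where
  field
    table  : Fin n → Fin n → Fin n
    row    : ∀ r → Bijective _≡_ _≡_ (λ c → table r c)
    column : ∀ c → Bijective _≡_ _≡_ (λ r → table r c)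

infix 4 _∈ᴸ_ _⊆ᴸ_
_∈ᴸ_ : ∀ {n} → Triple n → LatinSquare n → Set
(r , c , s) ∈ᴸ L = LatinSquare.table L r c ≡ s

_⊆ᴸ_ : ∀ {n} → TripleSet n → LatinSquare n → Set
T ⊆ᴸ L = ∀ {t} → t ∈ T → t ∈ᴸ L

record IsDisjointMate {n : ℕ} (T T′ : TripleSet n) : Set where
  field
    isPartialLatinSquare : IsPartialLatinSquare T′
    sameCells     : ∀ r c → (∃[ s ] (r , c , s) ∈ T) ⇔ (∃[ s ] (r , c , s) ∈ T′)
    disjoint      : ∀ {t} → t ∈ T → ¬ (t ∈ T′)
    rowSymbols    : ∀ r s → (∃[ c ] (r , c , s) ∈ T) ⇔ (∃[ c ] (r , c , s) ∈ T′)
    columnSymbols : ∀ c s → (∃[ r ] (r , c , s) ∈ T) ⇔ (∃[ r ] (r , c , s) ∈ T′)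

record IsLatinTrade {n : ℕ} (L : LatinSquare n) (T : TripleSet n) : Set where
  field
    subset : T ⊆ᴸ L
    mate   : ∃[ T′ ] IsDisjointMate T T′

-- m ≤ C · log₂ p over the reals, for p ≥ 1, exponentiated in base 2.
infix 4 _≤_·log₂_
_≤_·log₂_ : ℕ → ℕ → ℕ → Set
m ≤ C ·log₂ p = 2 ^ m ≤ p ^ C

toℕ-⊕ : ∀ {k} (i j : Fin (suc k)) → toℕ (i ⊕ j) ≡ (toℕ i ℕ.+ toℕ j) % suc k
toℕ-⊕ {k} i j = toℕ-fromℕ< (m%n<n (toℕ i ℕ.+ toℕ j) (suc k))

⊕-comm : ∀ {p} (i j : Fin p) → i ⊕ j ≡ j ⊕ i
⊕-comm {suc k} i j = cong (_mod suc k) (ℕₚ.+-comm (toℕ i) (toℕ j))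

private
  %-absorbʳ : ∀ a b n .{{_ : NonZero n}} → (a ℕ.+ b % n) % n ≡ (a ℕ.+ b) % n
  %-absorbʳ a b n = begin
    (a ℕ.+ b % n) % n             ≡⟨ %-distribˡ-+ a (b % n) n ⟩
    (a % n ℕ.+ b % n % n) % n     ≡⟨ cong (λ x → (a % n ℕ.+ x) % n) (m%n%n≡m%n b n) ⟩
    (a % n ℕ.+ b % n) % n         ≡⟨ %-distribˡ-+ a b n ⟨
    (a ℕ.+ b) % n                 ∎
    where open ≡-Reasoning

  cancel : ∀ a b {n} x .{{_ : NonZero n}} → a ℕ.+ b ≡ n → x ℕ.< n →
           (a ℕ.+ (b ℕ.+ x) % n) % n ≡ x
  cancel a b {n} x a+b≡n x<n = begin
    (a ℕ.+ (b ℕ.+ x) % n) % n  ≡⟨ %-absorbʳ a (b ℕ.+ x) n ⟩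
    (a ℕ.+ (b ℕ.+ x)) % n      ≡⟨ cong (_% n) (ℕₚ.+-assoc a b x) ⟨
    (a ℕ.+ b ℕ.+ x) % n        ≡⟨ cong (λ y → (y ℕ.+ x) % n) a+b≡n ⟩
    (n ℕ.+ x) % n              ≡⟨ cong (_% n) (ℕₚ.+-comm n x) ⟩
    (x ℕ.+ n) % n              ≡⟨ [m+n]%n≡m%n x n ⟩
    x % n                      ≡⟨ m<n⇒m%n≡m x<n ⟩
    x                          ∎
    where open ≡-Reasoning

  ⊕-bijectiveʳ : ∀ {p} (i : Fin p) → Bijective _≡_ _≡_ (i ⊕_)
  ⊕-bijectiveʳ {suc k} i = injective , surjective
    where
    n = suc k
    -i = n ∸ toℕ i

    injective : Injective _≡_ _≡_ (i ⊕_)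
    injective {x} {y} eq = toℕ-injective (begin
      toℕ x                                      ≡⟨ undo x ⟨
      (-i ℕ.+ toℕ (i ⊕ x)) % n                   ≡⟨ cong (λ z → (-i ℕ.+ toℕ z) % n) eq ⟩
      (-i ℕ.+ toℕ (i ⊕ y)) % n                   ≡⟨ undo y ⟩
      toℕ y                                      ∎)
      where
      open ≡-Reasoning
      undo : ∀ z → (-i ℕ.+ toℕ (i ⊕ z)) % n ≡ toℕ z
      undo z = trans (cong (λ w → (-i ℕ.+ w) % n) (toℕ-⊕ i z))
                     (cancel -i (toℕ i) (toℕ z) (ℕₚ.m∸n+n≡m (toℕ≤n i)) (toℕ<n z))

    surjective : ∀ s → ∃[ c ] (∀ {z} → z ≡ c → i ⊕ z ≡ s)
    surjective s = c , λ { refl → toℕ-injective (begin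
      toℕ (i ⊕ c)                                ≡⟨ toℕ-⊕ i c ⟩
      (toℕ i ℕ.+ toℕ c) % n                      ≡⟨ cong (λ z → (toℕ i ℕ.+ z) % n) (toℕ-fromℕ< _) ⟩
      (toℕ i ℕ.+ (-i ℕ.+ toℕ s) % n) % n         ≡⟨ cancel (toℕ i) -i (toℕ s) (ℕₚ.m+[n∸m]≡n (toℕ≤n i)) (toℕ<n s) ⟩
      toℕ s                                      ∎) }
      where
      open ≡-Reasoning
      c = (-i ℕ.+ toℕ s) mod n

  ⊕-bijectiveˡ : ∀ {p} (j : Fin p) → Bijective _≡_ _≡_ (_⊕ j)
  ⊕-bijectiveˡ j with ⊕-bijectiveʳ j
  ... | inj , surj =
      (λ {x} {y} eq → inj (trans (⊕-comm j x) (trans eq (⊕-comm y j))))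
    , (λ s → let (c , h) = surj s in c , λ {z} z≡c → trans (⊕-comm z j) (h z≡c))

B : ∀ p → LatinSquare p
B p = record
  { table  = _⊕_
  ; row    = ⊕-bijectiveʳ
  ; column = ⊕-bijectiveˡ
  }

{-# OPTIONS --safe #-}
module Submission where

-- Cut an h × w rectangle with h + w = p into squares and append one further
-- square of side h, so that the result is a tiling of a cylinder of
-- circumference p.  Send the square with top-left corner (x , y) and side d to
-- its antidiagonal s = x + y + d.  The cells (x , y + d) and (x + d , y) of B p
-- both carry s; these cells form T, and putting s into (x , y) and
-- (x + d , y + d) instead gives the mate.  The two sets of cells coincide since
-- in a tiling of a cylinder the corners of the squares cancel with sign.  All
-- that is needed is that the squares have distinct antidiagonals, and then each
-- symbol of T occurs exactly twice.
--
-- It remains to cut n × (n + 3) rectangles into O(log n) squares with distinct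
-- antidiagonals, which gives all odd p = 2n + 3 ≥ 5.  Such a tiling, scaled by 2 or 4
-- and surrounded by at most 9 squares, becomes one for N = 4n + 3, …, 4n + 6 or
-- 16n + 9, 12, 33, 36; some of these need a parity condition on n, but together
-- they reach every N outside a finite list.

open import Defs
open import Data.Nat as ℕ
  using (ℕ; zero; suc; _+_; _*_; _^_; _∸_; _≤_; _<_; _<ᵇ_; z≤n; s≤s; NonZero)
open import Data.Nat.Primality using (Prime; prime⇒irreducible; ¬prime[1])
open import Data.Fin as Fin using (Fin; toℕ)
open import Data.Product using (Σ; _×_; _,_; proj₁; proj₂; ∃-syntax)
open import Data.Sum using (_⊎_; inj₁; inj₂)
open import Relation.Binary.PropositionalEquality
  using (_≡_; _≢_; refl; sym; trans; cong; cong₂; subst; subst₂; module ≡-Reasoning)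
open import Data.Bool using (if_then_else_)
open import Data.Fin.Properties using (toℕ-fromℕ<; toℕ-injective)
open import Data.Integer as ℤ using (ℤ)
import Data.Integer.Properties as ℤₚ
import Data.Integer.Tactic.RingSolver as ℤ-Solver
open import Data.List using (List; []; _∷_; _++_; map; concatMap; length; filter)
open import Data.List.Membership.Propositional using () renaming (_∈_ to _∈ˡ_)
open import Data.List.Properties
  using (length-map; length-++; ++-identityʳ; concatMap-++; filter-accept; filter-reject; filter-none)
open import Data.List.Relation.Unary.All as All using (All; []; _∷_)
import Data.List.Relation.Unary.All.Properties as All
open import Data.List.Relation.Unary.AllPairs as AllPairs using (AllPairs; []; _∷_; allPairs?)
import Data.List.Relation.Unary.AllPairs.Properties as AllPairs
open import Data.List.Relation.Unary.Any using (here; there)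
open import Data.List.Relation.Unary.Unique.Propositional using (Unique)
open import Data.Nat.DivMod
  using (_%_; _mod_; _divMod_; result; m%n<n; n%n≡0; m<n⇒m%n≡m; %-distribˡ-+; %-remove-+ˡ; %-remove-+ʳ)
import Data.Nat.Divisibility as Div
open import Data.Nat.Divisibility using (_∣?_; divides; m∣m*n; ∣m⇒∣m*n)
open import Data.Nat.Induction using (<-rec)
open import Data.Nat.ListAction using (sum)
open import Data.Nat.Properties
import Data.Nat.Tactic.RingSolver as ℕ-Solver
open import Data.Product.Properties using (≡-dec)
open import Data.Unit using (⊤)
open import Function.Bundles using (mk⇔)
open import Relation.Binary.Definitions using (tri<; tri≈; tri>)
open import Relation.Nullary using (Dec; yes; no; ¬_; contradiction)
open import Relation.Nullary.Decidable
  using (_×-dec_; _⊎-dec_; ¬?; map′; from-yes; True; toWitness)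

-- Tilings by squares

record Square : Set where
  constructor ⟨_,_,_⟩
  field
    top left side : ℕ

open Square

antidiagonal : Square → ℕ
antidiagonal q = top q + left q + side q

-- The mixed second difference of `f` over a rectangle. The positive corners will hold the mate, the
-- negative ones the trade.
cornerSum : (ℕ → ℕ → ℤ) → (x x′ y y′ : ℕ) → ℤ
cornerSum f x x′ y y′ = f x y ℤ.+ f x′ y′ ℤ.- (f x y′ ℤ.+ f x′ y)

squareSum : (ℕ → ℕ → ℤ) → Square → ℤ
squareSum f ⟨ x , y , d ⟩ = cornerSum f x (x + d) y (y + d)

∑ : (Square → ℤ) → List Square → ℤ
∑ g []       = ℤ.0ℤ
∑ g (q ∷ qs) = g q ℤ.+ ∑ g qs

∑-++ : ∀ g qs rs → ∑ g (qs ++ rs) ≡ ∑ g qs ℤ.+ ∑ g rs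
∑-++ g []       rs = sym (ℤₚ.+-identityˡ _)
∑-++ g (q ∷ qs) rs = trans (cong (ℤ._+_ (g q)) (∑-++ g qs rs)) (sym (ℤₚ.+-assoc (g q) _ _))

∑-map : ∀ g h k → (∀ q → g (k q) ≡ h q) → ∀ qs → ∑ g (map k qs) ≡ ∑ h qs
∑-map g h k eq []       = refl
∑-map g h k eq (q ∷ qs) = cong₂ ℤ._+_ (eq q) (∑-map g h k eq qs)

-- The two corners on the common edge occur once with each sign and cancel.
cornerSum-beside : ∀ f x x′ y₁ y₂ y₃ →
  cornerSum f x x′ y₁ y₂ ℤ.+ cornerSum f x x′ y₂ y₃ ≡ cornerSum f x x′ y₁ y₃
cornerSum-beside f x x′ y₁ y₂ y₃ =
  telescope (f x y₁) (f x′ y₂) (f x y₂) (f x′ y₁) (f x′ y₃) (f x y₃)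
  where
  telescope : ∀ a b c d e g →
    (a ℤ.+ b ℤ.- (c ℤ.+ d)) ℤ.+ (c ℤ.+ e ℤ.- (g ℤ.+ b)) ≡ a ℤ.+ e ℤ.- (g ℤ.+ d)
  telescope = ℤ-Solver.solve-∀

cornerSum-above : ∀ f x₁ x₂ x₃ y y′ →
  cornerSum f x₁ x₂ y y′ ℤ.+ cornerSum f x₂ x₃ y y′ ≡ cornerSum f x₁ x₃ y y′
cornerSum-above f x₁ x₂ x₃ y y′ =
  telescope (f x₁ y) (f x₂ y′) (f x₁ y′) (f x₂ y) (f x₃ y′) (f x₃ y)
  where
  telescope : ∀ a b c d e g →
    (a ℤ.+ b ℤ.- (c ℤ.+ d)) ℤ.+ (d ℤ.+ e ℤ.- (b ℤ.+ g)) ≡ a ℤ.+ e ℤ.- (c ℤ.+ g)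
  telescope = ℤ-Solver.solve-∀

Distinct : List Square → Set
Distinct = AllPairs (λ q r → antidiagonal q ≢ antidiagonal r)

-- Of a tiling only its homological shadow is kept: the signed corners of the
-- squares add up to those of the rectangle.
record Tiling (h w : ℕ) : Set where
  field
    squares  : List Square
    balanced : ∀ f → ∑ (squareSum f) squares ≡ cornerSum f 0 h 0 w
    positive : All (λ q → 0 < side q) squares
    bounded  : All (λ q → antidiagonal q < h + w) squares
    distinct : Distinct squares

open Tiling

∣_∣ₜ : ∀ {h w} → Tiling h w → ℕ
∣ t ∣ₜ = length (squares t)

-- (a , b) stands for the function m ↦ a m + b.
Linear : Set
Linear = ℕ × ℕ

⟦_⟧ : Linear → ℕ → ℕ
⟦ a , b ⟧ m = a * m + b

infixl 6 _⊞_
infixl 7 _⊡_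
infix  4 _≼_

_⊞_ : Linear → Linear → Linear
(a , b) ⊞ (c , d) = a + c , b + d

_⊡_ : ℕ → Linear → Linear
k ⊡ (a , b) = k * a , k * b

-- Decidable, and it implies the inequality at every `m`, so that one computation settles all values
-- of the parameter.
_≼_ : Linear → Linear → Set
(a , b) ≼ (c , d) = a ≤ c × b ≤ d

_≼?_ : ∀ f g → Dec (f ≼ g)
(a , b) ≼? (c , d) = a ≤? c ×-dec b ≤? d

_≟ₗ_ : (f g : Linear) → Dec (f ≡ g)
_≟ₗ_ = ≡-dec _≟_ _≟_

⟦⊞⟧ : ∀ f g m → ⟦ f ⊞ g ⟧ m ≡ ⟦ f ⟧ m + ⟦ g ⟧ m
⟦⊞⟧ (a , b) (c , d) m = expand a b c d m
  where
  expand : ∀ a b c d m → (a + c) * m + (b + d) ≡ a * m + b + (c * m + d)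
  expand = ℕ-Solver.solve-∀

⟦⊡⟧ : ∀ k f m → ⟦ k ⊡ f ⟧ m ≡ k * ⟦ f ⟧ m
⟦⊡⟧ k (a , b) m = expand k a b m
  where
  expand : ∀ k a b m → k * a * m + k * b ≡ k * (a * m + b)
  expand = ℕ-Solver.solve-∀

⟦≼⟧ : ∀ {f g} m → f ≼ g → ⟦ f ⟧ m ≤ ⟦ g ⟧ m
⟦≼⟧ m (a≤c , b≤d) = +-mono-≤ (*-monoˡ-≤ m a≤c) b≤d

⊞-assoc : ∀ f g h → f ⊞ g ⊞ h ≡ f ⊞ (g ⊞ h)
⊞-assoc (a , b) (c , d) (e , g) = cong₂ _,_ (+-assoc a c e) (+-assoc b d g)

-- Scaling and surrounding a tiling

-- Guillotine dissections with sides linear in a parameter; `core` marks the place of the tiling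
-- that is being enlarged.
data Pattern : Set where
  core         : Pattern
  square       : Linear → Pattern
  beside above : Pattern → Pattern → Pattern

transpose : Pattern → Pattern
transpose core         = core
transpose (square d)   = square d
transpose (beside t u) = above (transpose t) (transpose u)
transpose (above t u)  = beside (transpose t) (transpose u)

-- k + 1 equal squares
row stack : ℕ → Linear → Pattern
row zero    d = square d
row (suc k) d = beside (square d) (row k d)
stack k d = transpose (row k d)

data Tile : Set where
  core   : Tile
  square : Linear → Tile

record Placed : Set where
  constructor _at_,_
  field
    tile : Tile
    x y  : Linear

newSquares cores : Pattern → ℕ
newSquares core         = 0
newSquares (square d)   = 1
newSquares (beside t u) = newSquares t + newSquares u
newSquares (above t u)  = newSquares t + newSquares u
cores core         = 1
cores (square d)   = 0
cores (beside t u) = cores t + cores u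
cores (above t u)  = cores t + cores u

module Substitution (s : ℕ) .{{_ : NonZero s}} (h w : Linear) where

  height width : Pattern → Linear
  height core         = s ⊡ h
  height (square d)   = d
  height (beside t u) = height t
  height (above t u)  = height t ⊞ height u
  width core         = s ⊡ w
  width (square d)   = d
  width (beside t u) = width t ⊞ width u
  width (above t u)  = width t

  Fits : Pattern → Set
  Fits core         = ⊤
  Fits (square d)   = (0 , 1) ≼ d
  Fits (beside t u) = height t ≡ height u × Fits t × Fits u
  Fits (above t u)  = width t ≡ width u × Fits t × Fits u

  fits? : ∀ t → Dec (Fits t)
  fits? core         = yes _
  fits? (square d)   = (0 , 1) ≼? d
  fits? (beside t u) = height t ≟ₗ height u ×-dec fits? t ×-dec fits? u
  fits? (above t u)  = width t ≟ₗ width u ×-dec fits? t ×-dec fits? u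

  place : Pattern → Linear → Linear → List Placed
  place core         x y = (core at x , y) ∷ []
  place (square d)   x y = (square d at x , y) ∷ []
  place (beside t u) x y = place t x y ++ place u x (y ⊞ width t)
  place (above t u)  x y = place t x y ++ place u (x ⊞ height t) y

  -- The antidiagonals of the squares replacing a placed tile lie in
  -- [lower , upper) and are congruent to residue modulo s.
  lower upper residue : Placed → Linear
  lower (core at x , y)        = x ⊞ y ⊞ (0 , 1)
  lower (square d at x , y)    = x ⊞ y ⊞ d
  upper (core at x , y)        = x ⊞ y ⊞ s ⊡ (h ⊞ w)
  upper (square d at x , y)    = x ⊞ y ⊞ d ⊞ (0 , 1)
  residue (core at x , y)      = x ⊞ y
  residue (square d at x , y)  = x ⊞ y ⊞ d

  -- Since `s` divides the leading coefficients, the residues modulo `s` do not depend on the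
  -- parameter.
  Incongruent : Linear → Linear → Set
  Incongruent (a , b) (c , d) = s Div.∣ a × s Div.∣ c × b % s ≢ d % s

  Apart : Placed → Placed → Set
  Apart p q = upper p ≼ lower q ⊎ upper q ≼ lower p ⊎ Incongruent (residue p) (residue q)

  apart? : ∀ p q → Dec (Apart p q)
  apart? p q = upper p ≼? lower q ⊎-dec upper q ≼? lower p ⊎-dec
    (s ∣? _ ×-dec s ∣? _ ×-dec ¬? (_ ≟ _))

  origin : Linear
  origin = 0 , 0

  Valid : Pattern → Set
  Valid t = Fits t
    × All (λ p → upper p ≼ height t ⊞ width t) (place t origin origin)
    × AllPairs Apart (place t origin origin)

  valid? : ∀ t → Dec (Valid t)
  valid? t = fits? t
    ×-dec All.all? (λ p → upper p ≼? _) (place t origin origin)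
    ×-dec allPairs? apart? (place t origin origin)

  module _ (m : ℕ) (T : Tiling (⟦ h ⟧ m) (⟦ w ⟧ m)) where

    scaled : Linear → Linear → Square → Square
    scaled x y ⟨ i , j , d ⟩ = ⟨ ⟦ x ⟧ m + s * i , ⟦ y ⟧ m + s * j , s * d ⟩

    fill : Placed → List Square
    fill (core at x , y)     = map (scaled x y) (squares T)
    fill (square d at x , y) = ⟨ ⟦ x ⟧ m , ⟦ y ⟧ m , ⟦ d ⟧ m ⟩ ∷ []

    -- Balance of `T` holds for every function on the grid, hence for `f` precomposed with the
    -- scaling; this settles the core. At the cuts, corners cancel along the common edge.
    fill-balanced : ∀ f t → Fits t → ∀ x y →
      ∑ (squareSum f) (concatMap fill (place t x y)) ≡
      cornerSum f (⟦ x ⟧ m) (⟦ x ⊞ height t ⟧ m) (⟦ y ⟧ m) (⟦ y ⊞ width t ⟧ m)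
    fill-balanced f core _ x y = begin
      ∑ (squareSum f) (map (scaled x y) (squares T) ++ [])
        ≡⟨ cong (∑ (squareSum f)) (++-identityʳ (map (scaled x y) (squares T))) ⟩
      ∑ (squareSum f) (map (scaled x y) (squares T))
        ≡⟨ ∑-map _ (squareSum g) (scaled x y) square-scaled (squares T) ⟩
      ∑ (squareSum g) (squares T)
        ≡⟨ balanced T g ⟩
      cornerSum f (X + s * 0) (X + s * ⟦ h ⟧ m) (Y + s * 0) (Y + s * ⟦ w ⟧ m)
        ≡⟨ cong₂ (λ X₀ Y₀ → cornerSum f X₀ (X + s * ⟦ h ⟧ m) Y₀ (Y + s * ⟦ w ⟧ m)) (start X) (start Y) ⟩
      cornerSum f X (X + s * ⟦ h ⟧ m) Y (Y + s * ⟦ w ⟧ m)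
        ≡⟨ cong₂ (λ X₁ Y₁ → cornerSum f X X₁ Y Y₁) (end x h) (end y w) ⟩
      cornerSum f X (⟦ x ⊞ s ⊡ h ⟧ m) Y (⟦ y ⊞ s ⊡ w ⟧ m) ∎
      where
      open ≡-Reasoning
      X = ⟦ x ⟧ m
      Y = ⟦ y ⟧ m
      g : ℕ → ℕ → ℤ
      g i j = f (X + s * i) (Y + s * j)
      start : ∀ z → z + s * 0 ≡ z
      start z = trans (cong (_+_ z) (*-zeroʳ s)) (+-identityʳ z)
      end : ∀ z k → ⟦ z ⟧ m + s * ⟦ k ⟧ m ≡ ⟦ z ⊞ s ⊡ k ⟧ m
      end z k = sym (trans (⟦⊞⟧ z (s ⊡ k) m) (cong (_+_ (⟦ z ⟧ m)) (⟦⊡⟧ s k m)))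
      shift : ∀ z i d → z + s * i + s * d ≡ z + s * (i + d)
      shift z i d = trans (+-assoc z _ _) (cong (_+_ z) (sym (*-distribˡ-+ s i d)))
      square-scaled : ∀ q → squareSum f (scaled x y q) ≡ squareSum g q
      square-scaled ⟨ i , j , d ⟩ =
        cong₂ (λ X₁ Y₁ → cornerSum f (X + s * i) X₁ (Y + s * j) Y₁) (shift X i d) (shift Y j d)
    fill-balanced f (square d) _ x y = trans (ℤₚ.+-identityʳ _)
      (cong₂ (λ X₁ Y₁ → cornerSum f (⟦ x ⟧ m) X₁ (⟦ y ⟧ m) Y₁) (sym (⟦⊞⟧ x d m)) (sym (⟦⊞⟧ y d m)))
    fill-balanced f (beside t u) (ht≡hu , ft , fu) x y = begin
      ∑ (squareSum f) (concatMap fill (place t x y ++ place u x (y ⊞ width t)))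
        ≡⟨ cong (∑ (squareSum f)) (concatMap-++ fill (place t x y) _) ⟩
      ∑ (squareSum f) (concatMap fill (place t x y) ++ concatMap fill (place u x (y ⊞ width t)))
        ≡⟨ ∑-++ _ (concatMap fill (place t x y)) _ ⟩
      ∑ (squareSum f) (concatMap fill (place t x y)) ℤ.+ ∑ (squareSum f) (concatMap fill (place u x (y ⊞ width t)))
        ≡⟨ cong₂ ℤ._+_ (fill-balanced f t ft x y) (fill-balanced f u fu x (y ⊞ width t)) ⟩
      cornerSum f X (⟦ x ⊞ height t ⟧ m) Y Y₁ ℤ.+
      cornerSum f X (⟦ x ⊞ height u ⟧ m) Y₁ (⟦ y ⊞ width t ⊞ width u ⟧ m)
        ≡⟨ cong₂ (λ k Y₂ → cornerSum f X (⟦ x ⊞ height t ⟧ m) Y Y₁ ℤ.+ cornerSum f X (⟦ x ⊞ k ⟧ m) Y₁ (⟦ Y₂ ⟧ m))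
             (sym ht≡hu) (⊞-assoc y (width t) (width u)) ⟩
      cornerSum f X (⟦ x ⊞ height t ⟧ m) Y Y₁ ℤ.+
      cornerSum f X (⟦ x ⊞ height t ⟧ m) Y₁ (⟦ y ⊞ (width t ⊞ width u) ⟧ m)
        ≡⟨ cornerSum-beside f X _ Y Y₁ _ ⟩
      cornerSum f X (⟦ x ⊞ height t ⟧ m) Y (⟦ y ⊞ (width t ⊞ width u) ⟧ m) ∎
      where
      open ≡-Reasoning
      X = ⟦ x ⟧ m
      Y = ⟦ y ⟧ m
      Y₁ = ⟦ y ⊞ width t ⟧ m
    fill-balanced f (above t u) (wt≡wu , ft , fu) x y = begin
      ∑ (squareSum f) (concatMap fill (place t x y ++ place u (x ⊞ height t) y))
        ≡⟨ cong (∑ (squareSum f)) (concatMap-++ fill (place t x y) _) ⟩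
      ∑ (squareSum f) (concatMap fill (place t x y) ++ concatMap fill (place u (x ⊞ height t) y))
        ≡⟨ ∑-++ _ (concatMap fill (place t x y)) _ ⟩
      ∑ (squareSum f) (concatMap fill (place t x y)) ℤ.+ ∑ (squareSum f) (concatMap fill (place u (x ⊞ height t) y))
        ≡⟨ cong₂ ℤ._+_ (fill-balanced f t ft x y) (fill-balanced f u fu (x ⊞ height t) y) ⟩
      cornerSum f X X₁ Y (⟦ y ⊞ width t ⟧ m) ℤ.+
      cornerSum f X₁ (⟦ x ⊞ height t ⊞ height u ⟧ m) Y (⟦ y ⊞ width u ⟧ m)
        ≡⟨ cong₂ (λ k X₂ → cornerSum f X X₁ Y (⟦ y ⊞ width t ⟧ m) ℤ.+ cornerSum f X₁ (⟦ X₂ ⟧ m) Y (⟦ y ⊞ k ⟧ m))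
             (sym wt≡wu) (⊞-assoc x (height t) (height u)) ⟩
      cornerSum f X X₁ Y (⟦ y ⊞ width t ⟧ m) ℤ.+
      cornerSum f X₁ (⟦ x ⊞ (height t ⊞ height u) ⟧ m) Y (⟦ y ⊞ width t ⟧ m)
        ≡⟨ cornerSum-above f X X₁ _ Y _ ⟩
      cornerSum f X (⟦ x ⊞ (height t ⊞ height u) ⟧ m) Y (⟦ y ⊞ width t ⟧ m) ∎
      where
      open ≡-Reasoning
      X = ⟦ x ⟧ m
      Y = ⟦ y ⟧ m
      X₁ = ⟦ x ⊞ height t ⟧ m

    antidiagonal-scaled : ∀ x y q → antidiagonal (scaled x y q) ≡ ⟦ x ⊞ y ⟧ m + s * antidiagonal q
    antidiagonal-scaled x y ⟨ i , j , d ⟩ =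
      trans (regroup (⟦ x ⟧ m) (⟦ y ⟧ m) s i j d) (cong (_+ s * (i + j + d)) (sym (⟦⊞⟧ x y m)))
      where
      regroup : ∀ X Y s i j d → X + s * i + (Y + s * j) + s * d ≡ X + Y + s * (i + j + d)
      regroup = ℕ-Solver.solve-∀

    antidiagonal-square : ∀ x y d → ⟦ x ⟧ m + ⟦ y ⟧ m + ⟦ d ⟧ m ≡ ⟦ x ⊞ y ⊞ d ⟧ m
    antidiagonal-square x y d =
      sym (trans (⟦⊞⟧ (x ⊞ y) d m) (cong (_+ ⟦ d ⟧ m) (⟦⊞⟧ x y m)))

    InRange : Placed → Square → Set
    InRange p q = ⟦ lower p ⟧ m ≤ antidiagonal q × antidiagonal q < ⟦ upper p ⟧ m
                × antidiagonal q % s ≡ ⟦ residue p ⟧ m % s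

    -- A square of the scaled core has antidiagonal `x + y + s * a` with `0 < a < h + w`, by
    -- `positive` and `bounded`.
    fill-inRange : ∀ p → All (InRange p) (fill p)
    fill-inRange (square d at x , y) =
      subst (λ z → ⟦ x ⊞ y ⊞ d ⟧ m ≤ z × z < ⟦ x ⊞ y ⊞ d ⊞ (0 , 1) ⟧ m × z % s ≡ ⟦ x ⊞ y ⊞ d ⟧ m % s)
        (sym (antidiagonal-square x y d))
        (≤-refl , ≤-reflexive (trans (+-comm 1 _) (sym (⟦⊞⟧ (x ⊞ y ⊞ d) (0 , 1) m))) , refl) ∷ []
    fill-inRange (core at x , y) = All.map⁺ (All.zipWith inRange (positive T , bounded T))
      where
      inRange : ∀ {q} → 0 < side q × antidiagonal q < ⟦ h ⟧ m + ⟦ w ⟧ m → InRange (core at x , y) (scaled x y q)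
      inRange {q} (0<d , q<h+w) rewrite antidiagonal-scaled x y q =
          ≤-trans (≤-reflexive (⟦⊞⟧ (x ⊞ y) (0 , 1) m))
            (+-monoʳ-≤ (⟦ x ⊞ y ⟧ m) (*-mono-≤ (ℕ.>-nonZero⁻¹ s) (≤-trans 0<d (m≤n+m _ _))))
        , ≤-trans (+-monoʳ-< (⟦ x ⊞ y ⟧ m) (*-monoʳ-< s q<h+w)) (≤-reflexive (sym total))
        , %-remove-+ʳ (⟦ x ⊞ y ⟧ m) (m∣m*n (antidiagonal q))
        where
        total : ⟦ x ⊞ y ⊞ s ⊡ (h ⊞ w) ⟧ m ≡ ⟦ x ⊞ y ⟧ m + s * (⟦ h ⟧ m + ⟦ w ⟧ m)
        total = trans (⟦⊞⟧ (x ⊞ y) (s ⊡ (h ⊞ w)) m)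
          (cong (_+_ (⟦ x ⊞ y ⟧ m)) (trans (⟦⊡⟧ s (h ⊞ w) m) (cong (_*_ s) (⟦⊞⟧ h w m))))

    fill-positive : ∀ t → Fits t → ∀ x y → All (λ q → 0 < side q) (concatMap fill (place t x y))
    fill-positive core _ x y rewrite ++-identityʳ (fill (core at x , y)) =
      All.map⁺ (All.map (*-mono-≤ (ℕ.>-nonZero⁻¹ s)) (positive T))
    fill-positive (square d) 1≼d x y = ⟦≼⟧ m 1≼d ∷ []
    fill-positive (beside t u) (_ , ft , fu) x y
      rewrite concatMap-++ fill (place t x y) (place u x (y ⊞ width t)) =
      All.++⁺ (fill-positive t ft x y) (fill-positive u fu x _)
    fill-positive (above t u) (_ , ft , fu) x y
      rewrite concatMap-++ fill (place t x y) (place u (x ⊞ height t) y) =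
      All.++⁺ (fill-positive t ft x y) (fill-positive u fu _ y)

    fill-distinct : ∀ p → Distinct (fill p)
    fill-distinct (square d at x , y) = [] ∷ []
    fill-distinct (core at x , y) = AllPairs.map⁺ (AllPairs.map different (distinct T))
      where
      different : ∀ {q r} → antidiagonal q ≢ antidiagonal r →
                  antidiagonal (scaled x y q) ≢ antidiagonal (scaled x y r)
      different {q} {r} q≢r rewrite antidiagonal-scaled x y q | antidiagonal-scaled x y r =
        λ eq → q≢r (*-cancelˡ-≡ _ _ s (+-cancelˡ-≡ (⟦ x ⊞ y ⟧ m) _ _ eq))

    incongruent-⟦⟧ : ∀ {f g} → Incongruent f g → ⟦ f ⟧ m % s ≢ ⟦ g ⟧ m % s
    incongruent-⟦⟧ {a , b} {c , d} (s∣a , s∣c , b≢d) eq = b≢d (begin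
      b % s             ≡⟨ %-remove-+ˡ b (∣m⇒∣m*n m s∣a) ⟨
      (a * m + b) % s   ≡⟨ eq ⟩
      (c * m + d) % s   ≡⟨ %-remove-+ˡ d (∣m⇒∣m*n m s∣c) ⟩
      d % s             ∎)
      where open ≡-Reasoning

    apart-distinct : ∀ p p′ → Apart p p′ →
      All (λ q → All (λ r → antidiagonal q ≢ antidiagonal r) (fill p′)) (fill p)
    apart-distinct p p′ apart =
      All.map (λ {q} q∈ → All.map (λ {r} → different {q} {r} apart q∈) (fill-inRange p′)) (fill-inRange p)
      where
      different : ∀ {q r} → Apart p p′ → InRange p q → InRange p′ r → antidiagonal q ≢ antidiagonal r
      different (inj₁ p≼p′) (_ , q< , _) (≤r , _ , _) =
        <⇒≢ (<-≤-trans q< (≤-trans (⟦≼⟧ m p≼p′) ≤r))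
      different (inj₂ (inj₁ p′≼p)) (≤q , _ , _) (_ , r< , _) =
        >⇒≢ (<-≤-trans r< (≤-trans (⟦≼⟧ m p′≼p) ≤q))
      different (inj₂ (inj₂ p≢p′)) (_ , _ , q≡) (_ , _ , r≡) eq =
        incongruent-⟦⟧ p≢p′ (trans (sym q≡) (trans (cong (_% s) eq) r≡))

    -- Within one tile distinctness is inherited, because scaling acts on antidiagonals by an
    -- injective affine map; between tiles it comes from `Apart`.
    substitute : ∀ t → Valid t → Tiling (⟦ height t ⟧ m) (⟦ width t ⟧ m)
    substitute t (fits , below , apart) = record
      { squares  = concatMap fill (place t origin origin)
      ; balanced = λ f → fill-balanced f t fits origin origin
      ; positive = fill-positive t fits origin origin
      ; bounded  = All.concat⁺ (All.map⁺ (All.map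
          (λ {p} p≼ → All.map (λ (_ , q< , _) → <-≤-trans q<
              (≤-trans (⟦≼⟧ m p≼) (≤-reflexive (⟦⊞⟧ (height t) (width t) m)))) (fill-inRange p))
          below))
      ; distinct = AllPairs.concat⁺ (All.map⁺ (All.universal fill-distinct _))
          (AllPairs.map⁺ (AllPairs.map
            (λ {p} {p′} → apart-distinct p p′) apart))
      }

    ∣substitute∣ : ∀ t v → ∣ substitute t v ∣ₜ ≡ newSquares t + cores t * ∣ T ∣ₜ
    ∣substitute∣ t _ = count t origin origin
      where
      open ≡-Reasoning
      regroup : ∀ a b c d n → a + b * n + (c + d * n) ≡ a + c + (b + d) * n
      regroup = ℕ-Solver.solve-∀
      join : ∀ t u ps qs →
        length (concatMap fill ps) ≡ newSquares t + cores t * ∣ T ∣ₜ →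
        length (concatMap fill qs) ≡ newSquares u + cores u * ∣ T ∣ₜ →
        length (concatMap fill (ps ++ qs)) ≡ newSquares t + newSquares u + (cores t + cores u) * ∣ T ∣ₜ
      join t u ps qs eq₁ eq₂ = begin
        length (concatMap fill (ps ++ qs))
          ≡⟨ cong length (concatMap-++ fill ps qs) ⟩
        length (concatMap fill ps ++ concatMap fill qs)
          ≡⟨ length-++ (concatMap fill ps) ⟩
        length (concatMap fill ps) + length (concatMap fill qs)
          ≡⟨ cong₂ _+_ eq₁ eq₂ ⟩
        newSquares t + cores t * ∣ T ∣ₜ + (newSquares u + cores u * ∣ T ∣ₜ)
          ≡⟨ regroup (newSquares t) (cores t) (newSquares u) (cores u) ∣ T ∣ₜ ⟩
        newSquares t + newSquares u + (cores t + cores u) * ∣ T ∣ₜ ∎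
      count : ∀ t x y → length (concatMap fill (place t x y)) ≡ newSquares t + cores t * ∣ T ∣ₜ
      count core x y = begin
        length (map (scaled x y) (squares T) ++ [])  ≡⟨ cong length (++-identityʳ (map (scaled x y) (squares T))) ⟩
        length (map (scaled x y) (squares T))        ≡⟨ length-map (scaled x y) (squares T) ⟩
        ∣ T ∣ₜ                                       ≡⟨ *-identityˡ ∣ T ∣ₜ ⟨
        1 * ∣ T ∣ₜ                                   ∎
      count (square d) x y = refl
      count (beside t u) x y = join t u (place t x y) _ (count t x y) (count u x _)
      count (above t u) x y = join t u (place t x y) _ (count t x y) (count u _ y)

open Substitution using (height; width; Valid; valid?; substitute; ∣substitute∣)

-- Logarithmic size and the enlargement steps

Short : ∀ {h w} → Tiling h w → Set
Short {h} {w} T = 2 ^ ∣ T ∣ₜ ≤ (h + w) ^ 6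

-- The width of a substituted pattern is the value of a linear function and equals `n + 3` only
-- propositionally. Storing it with an equation spares `enlarge` a transport of the tiling.
record Tileable (n : ℕ) : Set where
  field
    breadth   : ℕ
    breadth≡  : breadth ≡ n + 3
    tiling    : Tiling n breadth
    short     : Short tiling

record Enlarges (s : ℕ) .{{_ : NonZero s}} (t : Pattern) (f g : Linear) : Set where
  constructor enlarges
  h = f
  w = f ⊞ (0 , 3)
  field
    valid   : Valid s h w t
    height≡ : height s h w t ≡ g
    width≡  : width s h w t ≡ g ⊞ (0 , 3)
    cores≡  : cores t ≡ 1
    few     : newSquares t ≤ 9
    triples : 3 ⊡ (h ⊞ w) ≼ g ⊞ (g ⊞ (0 , 3))

enlarges? : ∀ s .{{_ : NonZero s}} t f g → Dec (Enlarges s t f g)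
enlarges? s t f g = map′
  (λ (a , b , c , d , e , f) → enlarges a b c d e f)
  (λ (enlarges a b c d e f) → a , b , c , d , e , f)
  (valid? s f (f ⊞ (0 , 3)) t
    ×-dec height s f (f ⊞ (0 , 3)) t ≟ₗ g ×-dec width s f (f ⊞ (0 , 3)) t ≟ₗ (g ⊞ (0 , 3))
    ×-dec cores t ≟ 1 ×-dec newSquares t ≤? 9 ×-dec _ ≼? _)

^-distribʳ-* : ∀ a b k → (a * b) ^ k ≡ a ^ k * b ^ k
^-distribʳ-* a b zero    = refl
^-distribʳ-* a b (suc k) = trans (cong (a * b *_) (^-distribʳ-* a b k)) (regroup a b (a ^ k) (b ^ k))
  where
  regroup : ∀ a b c d → a * b * (c * d) ≡ a * c * (b * d)
  regroup = ℕ-Solver.solve-∀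

⟦⊞3⟧ : ∀ f m → ⟦ f ⊞ (0 , 3) ⟧ m ≡ ⟦ f ⟧ m + 3
⟦⊞3⟧ f m = ⟦⊞⟧ f (0 , 3) m

-- The exponent 6 of `Short` is made for this step: nine new squares multiply the left side by at
-- most `2 ^ 9 = 512`, and a semiperimeter at least three times as large multiplies the right side
-- by at least `3 ^ 6 = 729`.
enlarge : ∀ {s} .{{_ : NonZero s}} {t f g} → Enlarges s t f g →
          ∀ m → Tileable (⟦ f ⟧ m) → Tileable (⟦ g ⟧ m)
enlarge {s} {t} {f} (enlarges valid refl width≡ cores≡ few triples) m
        record { breadth = b ; breadth≡ = b≡ ; tiling = T ; short = short }
  with refl ← trans b≡ (sym (⟦⊞3⟧ f m)) = record
  { breadth  = ⟦ width s f w t ⟧ m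
  ; breadth≡ = trans (cong (λ k → ⟦ k ⟧ m) width≡) (⟦⊞3⟧ g m)
  ; tiling   = substitute s f w m T t valid
  ; short    = begin
      2 ^ ∣ substitute s f w m T t valid ∣ₜ
        ≡⟨ cong (2 ^_) (∣substitute∣ s f w m T t valid) ⟩
      2 ^ (newSquares t + cores t * ∣ T ∣ₜ)
        ≡⟨ cong (λ c → 2 ^ (newSquares t + c)) (trans (cong (_* ∣ T ∣ₜ) cores≡) (*-identityˡ ∣ T ∣ₜ)) ⟩
      2 ^ (newSquares t + ∣ T ∣ₜ)
        ≡⟨ ^-distribˡ-+-* 2 (newSquares t) ∣ T ∣ₜ ⟩
      2 ^ newSquares t * 2 ^ ∣ T ∣ₜ
        ≤⟨ *-mono-≤ (≤-trans (^-monoʳ-≤ 2 few) (from-yes (2 ^ 9 ≤? 3 ^ 6))) short ⟩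
      3 ^ 6 * (⟦ f ⟧ m + ⟦ w ⟧ m) ^ 6
        ≡⟨ ^-distribʳ-* 3 (⟦ f ⟧ m + ⟦ w ⟧ m) 6 ⟨
      (3 * (⟦ f ⟧ m + ⟦ w ⟧ m)) ^ 6
        ≡⟨ cong (_^ 6) (trans (cong (3 *_) (sym (⟦⊞⟧ f w m))) (sym (⟦⊡⟧ 3 (f ⊞ w) m))) ⟩
      ⟦ 3 ⊡ (f ⊞ w) ⟧ m ^ 6
        ≤⟨ ^-monoˡ-≤ 6 (⟦≼⟧ m triples) ⟩
      ⟦ g ⊞ (g ⊞ (0 , 3)) ⟧ m ^ 6
        ≡⟨ cong (_^ 6) (trans (⟦⊞⟧ g (g ⊞ (0 , 3)) m) (cong (λ k → ⟦ g ⟧ m + ⟦ k ⟧ m) (sym width≡))) ⟩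
      (⟦ g ⟧ m + ⟦ width s f w t ⟧ m) ^ 6 ∎
  }
  where
  open ≤-Reasoning
  w = f ⊞ (0 , 3)
  g = height s f w t

unit : Tiling 1 1
unit = record
  { squares  = ⟨ 0 , 0 , 1 ⟩ ∷ []
  ; balanced = λ f → ℤₚ.+-identityʳ _
  ; positive = s≤s z≤n ∷ []
  ; bounded  = s≤s (s≤s z≤n) ∷ []
  ; distinct = [] ∷ []
  }

-- Euclid's algorithm; the last square, of side the gcd, is the core.
euclid : (fuel h w : ℕ) → Pattern
euclid zero       h w = core
euclid (suc fuel) h w =
  if h <ᵇ w then beside (square (0 , h)) (euclid fuel h (w ∸ h))
  else if w <ᵇ h then above (square (0 , w)) (euclid fuel (h ∸ w) w)
  else core

-- The core has height h and width w before scaling, by 2 in pattern₁ and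
-- pattern₄ and by 4 in the other two.
pattern₁ pattern₂ pattern₃ : Linear → Linear → Pattern
pattern₁ h w = beside (above core (square (2 ⊡ w))) (stack 1 (h ⊞ w))
pattern₂ h w = beside (above core (stack 2 (4 ⊡ w))) (above (square (3 ⊡ d)) (row 2 d))
  where d = h ⊞ 3 ⊡ w
pattern₃ h w = beside (above (beside core (row 1 (4 ⊡ h))) (square (4 ⊡ w ⊞ 8 ⊡ h))) (stack 3 (w ⊞ 3 ⊡ h))

-- Only fits together if e = (h + 2w) / 3 and d = (h + e) / 2.
pattern₄ : Linear → Linear → Linear → Pattern
pattern₄ h d e = beside (stack 3 d) (above (beside (stack 1 h) core) (beside (square (2 ⊡ e)) (stack 1 e)))

-- n is m + 1 here, and 2m + 3 or 2m + 2 where the parity of n matters: the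
-- shift makes coefficientwise comparison decide every inequality.
tileable-4n+6 : ∀ m → Tileable (1 * m + 1) → Tileable (4 * m + 10)
tileable-4n+6 = enlarge (from-yes (enlarges? 2 (pattern₁ (1 , 1) (1 , 4)) (1 , 1) (4 , 10)))

-- Before transposition the core has height `n + 3` and width `n`, so the arguments are
-- interchanged. One new square has antidiagonal `4n + 3`, within the range of the core; it is odd,
-- while the scaled core has only even ones.
tileable-4n+3 : ∀ m → Tileable (1 * m + 1) → Tileable (4 * m + 7)
tileable-4n+3 = enlarge (from-yes (enlarges? 2 (transpose (pattern₁ (1 , 4) (1 , 1))) (1 , 1) (4 , 7)))

-- In this step and the next three, the antidiagonals of all new squares lie beyond those of the
-- core.
tileable-16n+36 : ∀ m → Tileable (1 * m + 1) → Tileable (16 * m + 52)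
tileable-16n+36 = enlarge (from-yes (enlarges? 4 (pattern₂ (1 , 1) (1 , 4)) (1 , 1) (16 , 52)))

tileable-16n+9 : ∀ m → Tileable (1 * m + 1) → Tileable (16 * m + 25)
tileable-16n+9 = enlarge (from-yes (enlarges? 4 (transpose (pattern₂ (1 , 4) (1 , 1))) (1 , 1) (16 , 25)))

tileable-16n+12 : ∀ m → Tileable (1 * m + 1) → Tileable (16 * m + 28)
tileable-16n+12 = enlarge (from-yes (enlarges? 4 (pattern₃ (1 , 1) (1 , 4)) (1 , 1) (16 , 28)))

tileable-16n+33 : ∀ m → Tileable (1 * m + 1) → Tileable (16 * m + 49)
tileable-16n+33 = enlarge (from-yes (enlarges? 4 (transpose (pattern₃ (1 , 4) (1 , 1))) (1 , 1) (16 , 49)))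

-- The corner of the core lies on the odd antidiagonal `2n + 1`, and scaling by 2 keeps all
-- antidiagonals of the core odd. The new ones in their range, `2n + 2`, `3n + 1`, `3n + 3`,
-- `4n + 4` and `5n + 5`, are even because `n` is odd.
tileable-4n+4 : ∀ m → Tileable (2 * m + 3) → Tileable (8 * m + 16)
tileable-4n+4 = enlarge (from-yes (enlarges? 2 (pattern₄ (2 , 3) (2 , 4) (2 , 5)) (2 , 3) (8 , 16)))

-- Parity separates again: the core starts at `2n + 5`, and the new antidiagonals in its range,
-- `3n + 6`, `3n + 8`, `4n + 8` and `5n + 10`, are even for even `n`.
tileable-4n+5 : ∀ m → Tileable (2 * m + 2) → Tileable (8 * m + 13)
tileable-4n+5 = enlarge (from-yes (enlarges? 2 (transpose (pattern₄ (2 , 5) (2 , 4) (2 , 3))) (2 , 2) (8 , 13)))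

-- The core is a unit square scaled by `s`, which has to be the greatest common divisor of `n` and
-- `n + 3`, that is 1 or 3. Euclid's algorithm spends about `n / 3` squares here, so it serves only
-- for small `n`, each checked by evaluation.
Euclidean : ∀ s .{{_ : NonZero s}} → ℕ → Set
Euclidean s n = Valid s (0 , 1) (0 , 1) t
  × height s (0 , 1) (0 , 1) t ≡ (0 , n)
  × width s (0 , 1) (0 , 1) t ≡ (0 , n + 3)
  × 2 ^ (newSquares t + cores t * 1) ≤ (n + (n + 3)) ^ 6
  where t = euclid (n + 3) n (n + 3)

euclidean? : ∀ s .{{_ : NonZero s}} n → Dec (Euclidean s n)
euclidean? s n = valid? s (0 , 1) (0 , 1) (euclid (n + 3) n (n + 3))
  ×-dec _ ≟ₗ _ ×-dec _ ≟ₗ _ ×-dec _ ≤? _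

tileable-euclidean : ∀ s .{{_ : NonZero s}} n {_ : True (euclidean? s n)} → Tileable n
tileable-euclidean s n {c} with valid , height≡ , width≡ , short ← toWitness c =
  subst Tileable (cong (λ f → ⟦ f ⟧ 0) height≡) record
    { breadth  = ⟦ width s (0 , 1) (0 , 1) t ⟧ 0
    ; breadth≡ = cong₂ (λ f g → ⟦ f ⟧ 0) width≡ height≡ ∙ cong (_+ 3) (sym (cong (λ f → ⟦ f ⟧ 0) height≡))
    ; tiling   = substitute s (0 , 1) (0 , 1) 0 unit t valid
    ; short    = subst₂ _≤_ (cong (2 ^_) (sym (∣substitute∣ s (0 , 1) (0 , 1) 0 unit t valid)))
        (sym (cong₂ (λ f g → (⟦ f ⟧ 0 + ⟦ g ⟧ 0) ^ 6) height≡ width≡)) short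
    }
  where
  infixr 5 _∙_
  _∙_ = trans
  t = euclid (n + 3) n (n + 3)

-- Recursion on the short side

data Quarter : ℕ → Set where
  rem0 : ∀ q → Quarter (q * 4)
  rem1 : ∀ q → Quarter (1 + q * 4)
  rem2 : ∀ q → Quarter (2 + q * 4)
  rem3 : ∀ q → Quarter (3 + q * 4)

quarter : ∀ n → Quarter n
quarter 0 = rem0 0
quarter 1 = rem1 0
quarter 2 = rem2 0
quarter 3 = rem3 0
quarter (suc (suc (suc (suc n)))) with quarter n
... | rem0 q = rem0 (suc q)
... | rem1 q = rem1 (suc q)
... | rem2 q = rem2 (suc q)
... | rem3 q = rem3 (suc q)

-- The classes 2 and 3 modulo 4 come from `4n + 6` and `4n + 3`. With `n` odd, `4n + 4` reaches the
-- multiples of 8; with `n` even, `4n + 5` reaches 5 modulo 8. What remains, 4, 12, 1 and 9 modulo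
-- 16, comes from `16n + 36`, `16n + 12`, `16n + 33` and `16n + 9`. Small values that no admissible
-- `n` reaches are left to `tileable-euclidean`.
tileable-step : ∀ n → (∀ {k} → k < n → 0 < k → Tileable k) → 0 < n → Tileable n
tileable-step n rec 0<n = by-quarter (quarter n) rec 0<n
  where
  Smaller : ℕ → Set
  Smaller n = ∀ {k} → k < n → 0 < k → Tileable k

  descend : ∀ f g {_ : True ((0 , 1) ≼? f)} {_ : True ((f ⊞ (0 , 1)) ≼? g)} →
            (∀ m → Tileable (⟦ f ⟧ m) → Tileable (⟦ g ⟧ m)) →
            ∀ m {n} → ⟦ g ⟧ m ≡ n → Smaller n → Tileable n
  descend f g {0<f} {f<g} grow m refl rec = grow m (rec
    (≤-trans (≤-reflexive (trans (+-comm 1 _) (sym (⟦⊞⟧ f (0 , 1) m)))) (⟦≼⟧ m (toWitness f<g)))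
    (⟦≼⟧ m (toWitness 0<f)))

  by-quarter : ∀ {n} → Quarter n → Smaller n → 0 < n → Tileable n
  by-quarter (rem2 0)             rec _ = tileable-euclidean 1 2
  by-quarter (rem2 1)             rec _ = tileable-euclidean 3 6
  by-quarter (rem2 (suc (suc m))) rec _ = descend (1 , 1) (4 , 10) tileable-4n+6 m (eq m) rec
    where
    eq : ∀ m → 4 * m + 10 ≡ 2 + (2 + m) * 4
    eq = ℕ-Solver.solve-∀
  by-quarter (rem3 0)       rec _ = tileable-euclidean 3 3
  by-quarter (rem3 (suc m)) rec _ = descend (1 , 1) (4 , 7) tileable-4n+3 m (eq m) rec
    where
    eq : ∀ m → 4 * m + 7 ≡ 3 + (1 + m) * 4
    eq = ℕ-Solver.solve-∀
  by-quarter (rem0 q) rec 0<n with quarter q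
  ... | rem0 0       = contradiction 0<n λ ()
  ... | rem0 (suc j) = descend (2 , 3) (8 , 16) tileable-4n+4 (2 * j) (eq j) rec
    where
    eq : ∀ m → 8 * (2 * m) + 16 ≡ (1 + m) * 4 * 4
    eq = ℕ-Solver.solve-∀
  ... | rem2 0       = tileable-euclidean 1 8
  ... | rem2 (suc j) = descend (2 , 3) (8 , 16) tileable-4n+4 (1 + 2 * j) (eq j) rec
    where
    eq : ∀ m → 8 * (1 + 2 * m) + 16 ≡ (2 + (1 + m) * 4) * 4
    eq = ℕ-Solver.solve-∀
  ... | rem1 0 = tileable-euclidean 1 4
  ... | rem1 1 = tileable-euclidean 1 20
  ... | rem1 2 = tileable-euclidean 3 36
  ... | rem1 (suc (suc (suc m))) = descend (1 , 1) (16 , 52) tileable-16n+36 m (eq m) rec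
    where
    eq : ∀ m → 16 * m + 52 ≡ (1 + (3 + m) * 4) * 4
    eq = ℕ-Solver.solve-∀
  ... | rem3 0       = tileable-euclidean 3 12
  ... | rem3 (suc m) = descend (1 , 1) (16 , 28) tileable-16n+12 m (eq m) rec
    where
    eq : ∀ m → 16 * m + 28 ≡ (3 + (1 + m) * 4) * 4
    eq = ℕ-Solver.solve-∀
  by-quarter (rem1 q) rec _ with quarter q
  ... | rem0 0 = tileable-euclidean 1 1
  ... | rem0 1 = tileable-euclidean 1 17
  ... | rem0 2 = tileable-euclidean 3 33
  ... | rem0 (suc (suc (suc m))) = descend (1 , 1) (16 , 49) tileable-16n+33 m (eq m) rec
    where
    eq : ∀ m → 16 * m + 49 ≡ 1 + (3 + m) * 4 * 4
    eq = ℕ-Solver.solve-∀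
  ... | rem1 0       = tileable-euclidean 1 5
  ... | rem1 (suc j) = descend (2 , 2) (8 , 13) tileable-4n+5 (1 + 2 * j) (eq j) rec
    where
    eq : ∀ m → 8 * (1 + 2 * m) + 13 ≡ 1 + (1 + (1 + m) * 4) * 4
    eq = ℕ-Solver.solve-∀
  ... | rem2 0       = tileable-euclidean 3 9
  ... | rem2 (suc m) = descend (1 , 1) (16 , 25) tileable-16n+9 m (eq m) rec
    where
    eq : ∀ m → 16 * m + 25 ≡ 1 + (2 + (1 + m) * 4) * 4
    eq = ℕ-Solver.solve-∀
  ... | rem3 j = descend (2 , 2) (8 , 13) tileable-4n+5 (2 * j) (eq j) rec
    where
    eq : ∀ m → 8 * (2 * m) + 13 ≡ 1 + (3 + m * 4) * 4
    eq = ℕ-Solver.solve-∀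

tileable : ∀ n → 0 < n → Tileable n
tileable = <-rec (λ n → 0 < n → Tileable n) tileable-step

-- From a tiling to a trade

module _ {A : Set} (g : A → ℕ) where

  sum-positive : ∀ {xs} → 0 < sum (map g xs) → ∃[ x ] (x ∈ˡ xs × 0 < g x)
  sum-positive {x ∷ xs} 0<sum with g x in eq
  ... | suc _ = x , here refl , subst (0 <_) (sym eq) (s≤s z≤n)
  ... | zero  with y , y∈xs , 0<gy ← sum-positive {xs} 0<sum = y , there y∈xs , 0<gy

  term≤sum : ∀ {x xs} → x ∈ˡ xs → g x ≤ sum (map g xs)
  term≤sum (here refl)          = m≤m+n _ _
  term≤sum (there {x = y} x∈xs) = ≤-trans (term≤sum x∈xs) (m≤n+m _ (g y))

  sum≤1⇒unique : ∀ {x y xs} → sum (map g xs) ≤ 1 → x ∈ˡ xs → 0 < g x → y ∈ˡ xs → 0 < g y → x ≡ y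
  sum≤1⇒unique _ (here refl) _ (here refl) _ = refl
  sum≤1⇒unique sum≤1 (here refl) 0<gx (there y∈xs) 0<gy =
    contradiction (≤-trans (+-mono-≤ 0<gx (≤-trans 0<gy (term≤sum y∈xs))) sum≤1) λ { (s≤s ()) }
  sum≤1⇒unique sum≤1 (there x∈xs) 0<gx (here refl) 0<gy =
    contradiction (≤-trans (+-mono-≤ 0<gy (≤-trans 0<gx (term≤sum x∈xs))) sum≤1) λ { (s≤s ()) }
  sum≤1⇒unique {xs = z ∷ _} sum≤1 (there x∈xs) 0<gx (there y∈xs) 0<gy =
    sum≤1⇒unique (≤-trans (m≤n+m _ (g z)) sum≤1) x∈xs 0<gx y∈xs 0<gy

  -- Distinct keys leave at most one element with key `b`, so at most one term is nonzero.
  unique⇒sum≤1 : ∀ {B : Set} (key : A → B) b {xs} → AllPairs (λ x y → key x ≢ key y) xs →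
                 All (λ x → g x ≤ 1) xs → (∀ x → 0 < g x → key x ≡ b) → sum (map g xs) ≤ 1
  unique⇒sum≤1 key b [] [] _ = z≤n
  unique⇒sum≤1 key b {x ∷ xs} (x≢ ∷ distinct) (gx≤1 ∷ g≤1) support with g x in eq
  ... | zero  = unique⇒sum≤1 key b distinct g≤1 support
  ... | suc k = subst (_≤ 1) (sym (cong (suc k +_) rest≡0)) (subst (_≤ 1) (sym (+-identityʳ (suc k))) gx≤1)
    where
    rest≡0 : sum (map g xs) ≡ 0
    rest≡0 = n≤0⇒n≡0 (≮⇒≥ λ 0<sum → let y , y∈xs , 0<gy = sum-positive 0<sum in
      All.lookup x≢ y∈xs (trans (support x (subst (0 <_) (sym eq) (s≤s z≤n))) (sym (support y 0<gy))))

-- Residues modulo p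

toℕ-mod : ∀ {k} a → toℕ (a mod suc k) ≡ a % suc k
toℕ-mod {k} a = toℕ-fromℕ< (m%n<n a (suc k))

mod-⊕ : ∀ {k} a b → (a mod suc k) ⊕ (b mod suc k) ≡ (a + b) mod suc k
mod-⊕ {k} a b = toℕ-injective (begin
  toℕ ((a mod p) ⊕ (b mod p))             ≡⟨ toℕ-⊕ (a mod p) (b mod p) ⟩
  (toℕ (a mod p) + toℕ (b mod p)) % p     ≡⟨ cong₂ (λ i j → (i + j) % p) (toℕ-mod a) (toℕ-mod b) ⟩
  (a % p + b % p) % p                     ≡⟨ %-distribˡ-+ a b p ⟨
  (a + b) % p                             ≡⟨ toℕ-mod (a + b) ⟨
  toℕ ((a + b) mod p)                     ∎)
  where
  open ≡-Reasoning
  p = suc k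

mod-≡⇒%-≡ : ∀ {k} a b → a mod suc k ≡ b mod suc k → a % suc k ≡ b % suc k
mod-≡⇒%-≡ a b eq = trans (sym (toℕ-mod a)) (trans (cong toℕ eq) (toℕ-mod b))

-- Cancelling `a` modulo p is the injectivity of a row of `B p`.
+-mod-≢ : ∀ {k} a d → 0 < d → d < suc k → (a + d) mod suc k ≢ a mod suc k
+-mod-≢ {k} a d 0<d d<p eq = >⇒≢ 0<d (begin
  d       ≡⟨ m<n⇒m%n≡m d<p ⟨
  d % p   ≡⟨ mod-≡⇒%-≡ d 0 (proj₁ (LatinSquare.row (B p) (a mod p)) shifted) ⟩
  0       ∎)
  where
  open ≡-Reasoning
  p = suc k
  shifted : (a mod p) ⊕ (d mod p) ≡ (a mod p) ⊕ (0 mod p)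
  shifted = begin
    (a mod p) ⊕ (d mod p)   ≡⟨ mod-⊕ a d ⟩
    (a + d) mod p           ≡⟨ eq ⟩
    a mod p                 ≡⟨ cong (_mod p) (+-identityʳ a) ⟨
    (a + 0) mod p           ≡⟨ mod-⊕ a 0 ⟨
    (a mod p) ⊕ (0 mod p)   ∎

-- Residues are represented by 1, ..., p rather than 0, ..., p - 1, because the square that closes
-- the cylinder has antidiagonal exactly p. As `0 < a`, the difference `b ∸ a` is still less than p.
<-mod-≢ : ∀ {k a b} → 0 < a → a < b → b ≤ suc k → b mod suc k ≢ a mod suc k
<-mod-≢ {k} {a} {b} 0<a a<b b≤p eq =
  +-mod-≢ a (b ∸ a) (m<n⇒0<n∸m a<b) (<-≤-trans (∸-monoʳ-< 0<a (<⇒≤ a<b)) b≤p)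
    (trans (cong (_mod suc k) (m+[n∸m]≡n (<⇒≤ a<b))) eq)

mod-injective : ∀ {k a b} → 0 < a → a ≤ suc k → 0 < b → b ≤ suc k →
                a mod suc k ≡ b mod suc k → a ≡ b
mod-injective {a = a} {b} 0<a a≤p 0<b b≤p eq with <-cmp a b
... | tri< a<b _ _ = contradiction (sym eq) (<-mod-≢ 0<a a<b b≤p)
... | tri≈ _ a≡b _ = a≡b
... | tri> _ _ b<a = contradiction eq (<-mod-≢ 0<b b<a a≤p)

-- Two cells for each symbol

Cell : ℕ → Set
Cell n = Fin n × Fin n

module _ {n : ℕ} where

  -- Kronecker's delta; summed over corners, it counts how often a cell is used.
  δ : Cell n → Cell n → ℕ
  δ κ κ′ with ≡-dec Fin._≟_ Fin._≟_ κ κ′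
  ... | yes _ = 1
  ... | no  _ = 0

  δ-refl : ∀ κ → δ κ κ ≡ 1
  δ-refl κ with ≡-dec Fin._≟_ Fin._≟_ κ κ
  ... | yes _   = refl
  ... | no  κ≢κ = contradiction refl κ≢κ

  δ-positive : ∀ κ κ′ → 0 < δ κ κ′ → κ ≡ κ′
  δ-positive κ κ′ 0<δ with ≡-dec Fin._≟_ Fin._≟_ κ κ′
  ... | yes κ≡κ′ = κ≡κ′

  δ+δ-positive : ∀ κ κ₁ κ₂ → 0 < δ κ κ₁ + δ κ κ₂ → κ ≡ κ₁ ⊎ κ ≡ κ₂
  δ+δ-positive κ κ₁ κ₂ 0<δ with ≡-dec Fin._≟_ Fin._≟_ κ κ₁
  ... | yes κ≡κ₁ = inj₁ κ≡κ₁
  ... | no  _    = inj₂ (δ-positive κ κ₂ 0<δ)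

  δ+δ≤1 : ∀ κ κ₁ κ₂ → κ₁ ≢ κ₂ → δ κ κ₁ + δ κ κ₂ ≤ 1
  δ+δ≤1 κ κ₁ κ₂ κ₁≢κ₂ with ≡-dec Fin._≟_ Fin._≟_ κ κ₁ | ≡-dec Fin._≟_ Fin._≟_ κ κ₂
  ... | yes refl | yes refl = contradiction refl κ₁≢κ₂
  ... | yes _    | no  _    = s≤s z≤n
  ... | no  _    | yes _    = s≤s z≤n
  ... | no  _    | no  _    = z≤n

-- Instantiated for the trade and again for its mate: the keys are antidiagonals modulo p, and `u`,
-- `v` are opposite corners of a square.
module Pairs {A : Set} {n : ℕ} (key : A → Fin n) (u v : A → Cell n) where

  triple : (A → Cell n) → A → Triple n
  triple w a = proj₁ (w a) , proj₂ (w a) , key a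

  pairs : List A → List (Triple n)
  pairs = concatMap (λ a → triple u a ∷ triple v a ∷ [])

  ∈-pairsˡ : ∀ {a as} → a ∈ˡ as → triple u a ∈ˡ pairs as
  ∈-pairsˡ (here refl)  = here refl
  ∈-pairsˡ (there a∈as) = there (there (∈-pairsˡ a∈as))

  ∈-pairsʳ : ∀ {a as} → a ∈ˡ as → triple v a ∈ˡ pairs as
  ∈-pairsʳ (here refl)  = there (here refl)
  ∈-pairsʳ (there a∈as) = there (there (∈-pairsʳ a∈as))

  ∈-pairs⁻ : ∀ {t} as → t ∈ˡ pairs as → ∃[ a ] (a ∈ˡ as × (t ≡ triple u a ⊎ t ≡ triple v a))
  ∈-pairs⁻ (a ∷ as) (here eq)            = a , here refl , inj₁ eq
  ∈-pairs⁻ (a ∷ as) (there (here eq))    = a , here refl , inj₂ eq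
  ∈-pairs⁻ (a ∷ as) (there (there t∈as)) with b , b∈as , eq ← ∈-pairs⁻ as t∈as = b , there b∈as , eq

  length-pairs : ∀ as → length (pairs as) ≡ length as + length as
  length-pairs []       = refl
  length-pairs (a ∷ as) = cong suc (trans (cong suc (length-pairs as)) (sym (+-suc _ _)))

  Keyed : List A → Set
  Keyed = AllPairs (λ a b → key a ≢ key b)

  fresh : ∀ {s as} → All (λ a → s ≢ key a) as → All (λ t → s ≢ symbol t) (pairs as)
  fresh []           = []
  fresh (s≢ ∷ fresh-as) = s≢ ∷ s≢ ∷ fresh fresh-as

  pairs-unique : ∀ {as} → Keyed as → All (λ a → u a ≢ v a) as → Unique (pairs as)
  pairs-unique []              []            = []
  pairs-unique (a≢as ∷ keyed) (ua≢va ∷ u≢v) =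
      ((λ eq → ua≢va (cong (λ (r , c , _) → r , c) eq)) ∷ All.map (λ s≢ eq → s≢ (cong symbol eq)) (fresh a≢as))
    ∷ All.map (λ s≢ eq → s≢ (cong symbol eq)) (fresh a≢as)
    ∷ pairs-unique keyed u≢v

  -- Only the element with key `s`, if there is one, contributes, and it contributes both of its
  -- triples.
  symbol-twice : ∀ {as} → Keyed as → ∀ s →
    length (filter (λ t → symbol t Fin.≟ s) (pairs as)) ≡ 2 ⊎
    length (filter (λ t → symbol t Fin.≟ s) (pairs as)) ≡ 0
  symbol-twice []                       s = inj₂ refl
  symbol-twice {a ∷ as} (a≢as ∷ keyed) s = by-key (key a Fin.≟ s)
    where
    P? = λ (t : Triple n) → symbol t Fin.≟ s
    by-key : Dec (key a ≡ s) →
      length (filter P? (pairs (a ∷ as))) ≡ 2 ⊎ length (filter P? (pairs (a ∷ as))) ≡ 0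
    by-key (no key≢s)
      rewrite filter-reject P? {triple u a} {triple v a ∷ pairs as} key≢s
            | filter-reject P? {triple v a} {pairs as} key≢s = symbol-twice keyed s
    by-key (yes key≡s)
      rewrite filter-accept P? {triple u a} {triple v a ∷ pairs as} key≡s
            | filter-accept P? {triple v a} {pairs as} key≡s
            | filter-none P? (All.map (λ s≢ eq → s≢ (trans key≡s (sym eq))) (fresh a≢as)) = inj₁ refl

  weight : Cell n → A → ℕ
  weight κ a = δ κ (u a) + δ κ (v a)

  occupied⁺ : ∀ {r c a as} → a ∈ˡ as → 0 < weight (r , c) a → (r , c , key a) ∈ˡ pairs as
  occupied⁺ {r} {c} {a} a∈as 0<w with δ+δ-positive (r , c) (u a) (v a) 0<w
  ... | inj₁ refl = ∈-pairsˡ a∈as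
  ... | inj₂ refl = ∈-pairsʳ a∈as

  occupied⁻ : ∀ {r c s} as → (r , c , s) ∈ˡ pairs as →
              ∃[ a ] (a ∈ˡ as × key a ≡ s × 0 < weight (r , c) a)
  occupied⁻ as t∈ with ∈-pairs⁻ as t∈
  ... | a , a∈as , inj₁ refl = a , a∈as , refl ,
        ≤-trans (≤-reflexive (sym (δ-refl (u a)))) (m≤m+n _ _)
  ... | a , a∈as , inj₂ refl = a , a∈as , refl ,
        ≤-trans (≤-reflexive (sym (δ-refl (v a)))) (m≤n+m _ (δ (v a) (u a)))

  key-injective : ∀ {as a b} → Keyed as → a ∈ˡ as → b ∈ˡ as → key a ≡ key b → a ≡ b
  key-injective _             (here refl)  (here refl)  _  = refl
  key-injective (a≢as ∷ _)    (here refl)  (there b∈as) eq = contradiction eq (All.lookup a≢as b∈as)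
  key-injective (b≢as ∷ _)    (there a∈as) (here refl)  eq = contradiction (sym eq) (All.lookup b≢as a∈as)
  key-injective (_ ∷ keyed)   (there a∈as) (there b∈as) eq = key-injective keyed a∈as b∈as eq

  same-symbol : ∀ {r r′ c c′ s a b} → (r , c , s) ≡ triple u a ⊎ (r , c , s) ≡ triple v a →
                (r′ , c′ , s) ≡ triple u b ⊎ (r′ , c′ , s) ≡ triple v b → key a ≡ key b
  same-symbol e e′ = trans (sym (read e)) (read e′)
    where
    read : ∀ {t a} → t ≡ triple u a ⊎ t ≡ triple v a → symbol t ≡ key a
    read (inj₁ refl) = refl
    read (inj₂ refl) = refl

  -- Equal symbols come from one element, whose two cells lie in different rows.
  same-row : ∀ {as} → Keyed as → (∀ {a} → a ∈ˡ as → proj₁ (u a) ≢ proj₁ (v a)) →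
             ∀ {r c c′ s} → (r , c , s) ∈ˡ pairs as → (r , c′ , s) ∈ˡ pairs as → c ≡ c′
  same-row {as} keyed u≢v t∈ t′∈ with ∈-pairs⁻ as t∈ | ∈-pairs⁻ as t′∈
  ... | a , a∈ , e | b , b∈ , e′ with refl ← key-injective keyed a∈ b∈ (same-symbol e e′) = compare e e′
    where
    compare : ∀ {r c c′ s} → (r , c , s) ≡ triple u a ⊎ (r , c , s) ≡ triple v a →
              (r , c′ , s) ≡ triple u a ⊎ (r , c′ , s) ≡ triple v a → c ≡ c′
    compare (inj₁ refl) (inj₁ refl) = refl
    compare (inj₁ refl) (inj₂ eq)   = contradiction (cong proj₁ eq) (u≢v a∈)
    compare (inj₂ refl) (inj₁ eq)   = contradiction (sym (cong proj₁ eq)) (u≢v a∈)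
    compare (inj₂ refl) (inj₂ refl) = refl

  same-column : ∀ {as} → Keyed as → (∀ {a} → a ∈ˡ as → proj₂ (u a) ≢ proj₂ (v a)) →
                ∀ {r r′ c s} → (r , c , s) ∈ˡ pairs as → (r′ , c , s) ∈ˡ pairs as → r ≡ r′
  same-column {as} keyed u≢v t∈ t′∈ with ∈-pairs⁻ as t∈ | ∈-pairs⁻ as t′∈
  ... | a , a∈ , e | b , b∈ , e′ with refl ← key-injective keyed a∈ b∈ (same-symbol e e′) = compare e e′
    where
    col : Triple n → Fin n
    col (_ , c , _) = c
    compare : ∀ {r r′ c s} → (r , c , s) ≡ triple u a ⊎ (r , c , s) ≡ triple v a →
              (r′ , c , s) ≡ triple u a ⊎ (r′ , c , s) ≡ triple v a → r ≡ r′
    compare (inj₁ refl) (inj₁ refl) = refl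
    compare (inj₁ refl) (inj₂ eq)   = contradiction (cong col eq) (u≢v a∈)
    compare (inj₂ refl) (inj₁ eq)   = contradiction (sym (cong col eq)) (u≢v a∈)
    compare (inj₂ refl) (inj₂ refl) = refl

-- The trade and its mate

module Trade {k : ℕ} (Q : List Square)
  (small : All (λ q → 0 < side q × side q < suc k) Q)
  (keyed : AllPairs (λ q r → antidiagonal q mod suc k ≢ antidiagonal r mod suc k) Q)
  (balanced : ∀ (f : Cell (suc k) → ℤ) →
    ∑ (squareSum (λ x y → f (x mod suc k , y mod suc k))) Q ≡ ℤ.0ℤ)
  where

  p : ℕ
  p = suc k

  key : Square → Fin p
  key q = antidiagonal q mod p

  row₀ row₁ col₀ col₁ : Square → Fin p
  row₀ q = top q mod p
  row₁ q = (top q + side q) mod p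
  col₀ q = left q mod p
  col₁ q = (left q + side q) mod p

  corner₀₀ corner₁₁ corner₀₁ corner₁₀ : Square → Cell p
  corner₀₀ q = row₀ q , col₀ q
  corner₁₁ q = row₁ q , col₁ q
  corner₀₁ q = row₀ q , col₁ q
  corner₁₀ q = row₁ q , col₀ q

  module M  = Pairs key corner₀₁ corner₁₀
  module M′ = Pairs key corner₀₀ corner₁₁

  row₁≢row₀ : ∀ {q} → q ∈ˡ Q → row₁ q ≢ row₀ q
  row₁≢row₀ {q} q∈Q = let 0<d , d<p = All.lookup small q∈Q in +-mod-≢ (top q) (side q) 0<d d<p

  col₁≢col₀ : ∀ {q} → q ∈ˡ Q → col₁ q ≢ col₀ q
  col₁≢col₀ {q} q∈Q = let 0<d , d<p = All.lookup small q∈Q in +-mod-≢ (left q) (side q) 0<d d<p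

  T T′ : TripleSet p
  T  = record { elements = M.pairs Q
              ; unique = M.pairs-unique keyed (All.tabulate λ q∈Q eq → row₁≢row₀ q∈Q (sym (cong proj₁ eq))) }
  T′ = record { elements = M′.pairs Q
              ; unique = M′.pairs-unique keyed (All.tabulate λ q∈Q eq → row₁≢row₀ q∈Q (sym (cong proj₁ eq))) }

  same : ∀ {q r} → q ∈ˡ Q → r ∈ˡ Q → key q ≡ key r → q ≡ r
  same = M.key-injective keyed

  row₀⊕col₁ : ∀ q → row₀ q ⊕ col₁ q ≡ key q
  row₀⊕col₁ q = trans (mod-⊕ (top q) (left q + side q)) (cong (_mod p) (sym (+-assoc (top q) _ _)))

  row₁⊕col₀ : ∀ q → row₁ q ⊕ col₀ q ≡ key q
  row₁⊕col₀ q = trans (mod-⊕ (top q + side q) (left q)) (cong (_mod p) (swap (top q) (side q) (left q)))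
    where
    swap : ∀ x d y → x + d + y ≡ x + y + d
    swap = ℕ-Solver.solve-∀

  T⊆B : T ⊆ᴸ B p
  T⊆B t∈T with M.∈-pairs⁻ Q t∈T
  ... | q , _ , inj₁ refl = row₀⊕col₁ q
  ... | q , _ , inj₂ refl = row₁⊕col₀ q

  -- `balanced` is applied to the indicator function of `κ`: the positive corners count the cells of
  -- `T′`, the negative ones those of `T`.
  total-weight : ∀ κ → sum (map (M.weight κ) Q) ≡ sum (map (M′.weight κ) Q)
  total-weight κ = sym (ℤₚ.+-injective (ℤₚ.i-j≡0⇒i≡j _ _ (trans (sym (difference Q)) (balanced (λ κ′ → ℤ.+ δ κ κ′)))))
    where
    regroup : ∀ a b c d → a ℤ.- b ℤ.+ (c ℤ.- d) ≡ a ℤ.+ c ℤ.- (b ℤ.+ d)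
    regroup = ℤ-Solver.solve-∀
    difference : ∀ qs → ∑ (squareSum (λ x y → ℤ.+ δ κ (x mod p , y mod p))) qs ≡
                        ℤ.+ sum (map (M′.weight κ) qs) ℤ.- ℤ.+ sum (map (M.weight κ) qs)
    difference []       = refl
    difference (q ∷ qs) = trans (cong (ℤ._+_ (ℤ.+ M′.weight κ q ℤ.- ℤ.+ M.weight κ q)) (difference qs))
      (regroup (ℤ.+ M′.weight κ q) (ℤ.+ M.weight κ q)
        (ℤ.+ sum (map (M′.weight κ) qs)) (ℤ.+ sum (map (M.weight κ) qs)))

  -- A square that contributes the cell `(r , c)` to `T` has key `r ⊕ c`, and the keys are distinct.
  weight-total≤1 : ∀ κ → sum (map (M.weight κ) Q) ≤ 1
  weight-total≤1 κ@(r , c) = unique⇒sum≤1 (M.weight κ) key (r ⊕ c) keyed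
    (All.tabulate λ {q} q∈Q → δ+δ≤1 κ (corner₀₁ q) (corner₁₀ q) λ eq → row₁≢row₀ q∈Q (sym (cong proj₁ eq)))
    on-antidiagonal
    where
    on-antidiagonal : ∀ q → 0 < M.weight κ q → key q ≡ r ⊕ c
    on-antidiagonal q 0<w with δ+δ-positive κ (corner₀₁ q) (corner₁₀ q) 0<w
    ... | inj₁ refl = sym (row₀⊕col₁ q)
    ... | inj₂ refl = sym (row₁⊕col₀ q)

  transfer : ∀ (w₁ w₂ : Square → ℕ) → sum (map w₁ Q) ≡ sum (map w₂ Q) →
             ∀ {q} → q ∈ˡ Q → 0 < w₁ q → ∃[ q′ ] (q′ ∈ˡ Q × 0 < w₂ q′)
  transfer w₁ w₂ eq q∈Q 0<w =
    sum-positive w₂ (subst (0 <_) eq (≤-trans 0<w (term≤sum w₁ q∈Q)))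

  T′-isPartialLatinSquare : IsPartialLatinSquare T′
  T′-isPartialLatinSquare = record
    { cell   = cell
    ; row    = M′.same-row keyed λ q∈Q eq → row₁≢row₀ q∈Q (sym eq)
    ; column = M′.same-column keyed λ q∈Q eq → col₁≢col₀ q∈Q (sym eq)
    }
    where
    -- In `T′` the symbol is not the sum of row and column, so the multiplicity bound is carried
    -- over from `T` by `total-weight`.
    cell : ∀ {r c s s′} → (r , c , s) ∈ T′ → (r , c , s′) ∈ T′ → s ≡ s′
    cell {r} {c} t∈ t′∈ with M′.occupied⁻ Q t∈ | M′.occupied⁻ Q t′∈
    ... | q , q∈Q , refl , 0<w | q′ , q′∈Q , refl , 0<w′ =
      cong key (sum≤1⇒unique (M′.weight (r , c))
        (subst (_≤ 1) (total-weight (r , c)) (weight-total≤1 (r , c))) q∈Q 0<w q′∈Q 0<w′)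

  T′-isDisjointMate : IsDisjointMate T T′
  T′-isDisjointMate = record
    { isPartialLatinSquare = T′-isPartialLatinSquare
    -- The squares that fill a cell in `T` and in `T′` may differ; only the total weights are
    -- compared.
    ; sameCells = λ r c → mk⇔
        (λ (s , t∈) → let q , q∈Q , _ , 0<w = M.occupied⁻ Q t∈
                          q′ , q′∈Q , 0<w′ = transfer (M.weight (r , c)) (M′.weight (r , c)) (total-weight (r , c)) q∈Q 0<w
                      in key q′ , M′.occupied⁺ q′∈Q 0<w′)
        (λ (s , t∈) → let q , q∈Q , _ , 0<w = M′.occupied⁻ Q t∈
                          q′ , q′∈Q , 0<w′ = transfer (M′.weight (r , c)) (M.weight (r , c)) (sym (total-weight (r , c))) q∈Q 0<w
                      in key q′ , M.occupied⁺ q′∈Q 0<w′)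
    ; disjoint      = disjoint
    ; rowSymbols    = λ _ _ → mk⇔ to-row′ from-row′
    ; columnSymbols = λ _ _ → mk⇔ to-column′ from-column′
    }
    where
    -- By its symbol, a common triple would come from one square, whose corners on the two diagonals
    -- differ in row or column modulo p.
    disjoint : ∀ {t} → t ∈ T → ¬ (t ∈ T′)
    disjoint t∈T t∈T′ with M.∈-pairs⁻ Q t∈T | M′.∈-pairs⁻ Q t∈T′
    ... | q , q∈Q , inj₁ e | q′ , q′∈Q , inj₁ e′ with eq ← trans (sym e) e′ with refl ← same q∈Q q′∈Q (cong symbol eq) =
      col₁≢col₀ q∈Q (cong (λ (_ , c , _) → c) eq)
    ... | q , q∈Q , inj₁ e | q′ , q′∈Q , inj₂ e′ with eq ← trans (sym e) e′ with refl ← same q∈Q q′∈Q (cong symbol eq) =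
      row₁≢row₀ q∈Q (sym (cong proj₁ eq))
    ... | q , q∈Q , inj₂ e | q′ , q′∈Q , inj₁ e′ with eq ← trans (sym e) e′ with refl ← same q∈Q q′∈Q (cong symbol eq) =
      row₁≢row₀ q∈Q (cong proj₁ eq)
    ... | q , q∈Q , inj₂ e | q′ , q′∈Q , inj₂ e′ with eq ← trans (sym e) e′ with refl ← same q∈Q q′∈Q (cong symbol eq) =
      col₁≢col₀ q∈Q (sym (cong (λ (_ , c , _) → c) eq))
    -- Each side of a square has one endpoint in `T` and the other in `T′`, so the same square
    -- serves; likewise in the three statements that follow.
    to-row′ : ∀ {r s} → ∃[ c ] (r , c , s) ∈ T → ∃[ c ] (r , c , s) ∈ T′
    to-row′ (_ , t∈) with M.∈-pairs⁻ Q t∈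
    ... | q , q∈Q , inj₁ refl = _ , M′.∈-pairsˡ q∈Q
    ... | q , q∈Q , inj₂ refl = _ , M′.∈-pairsʳ q∈Q
    from-row′ : ∀ {r s} → ∃[ c ] (r , c , s) ∈ T′ → ∃[ c ] (r , c , s) ∈ T
    from-row′ (_ , t∈) with M′.∈-pairs⁻ Q t∈
    ... | q , q∈Q , inj₁ refl = _ , M.∈-pairsˡ q∈Q
    ... | q , q∈Q , inj₂ refl = _ , M.∈-pairsʳ q∈Q
    to-column′ : ∀ {c s} → ∃[ r ] (r , c , s) ∈ T → ∃[ r ] (r , c , s) ∈ T′
    to-column′ (_ , t∈) with M.∈-pairs⁻ Q t∈
    ... | q , q∈Q , inj₁ refl = _ , M′.∈-pairsʳ q∈Q
    ... | q , q∈Q , inj₂ refl = _ , M′.∈-pairsˡ q∈Q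
    from-column′ : ∀ {c s} → ∃[ r ] (r , c , s) ∈ T′ → ∃[ r ] (r , c , s) ∈ T
    from-column′ (_ , t∈) with M′.∈-pairs⁻ Q t∈
    ... | q , q∈Q , inj₁ refl = _ , M.∈-pairsʳ q∈Q
    ... | q , q∈Q , inj₂ refl = _ , M.∈-pairsˡ q∈Q

  T-isLatinTrade : IsLatinTrade (B p) T
  T-isLatinTrade = record { subset = T⊆B ; mate = T′ , T′-isDisjointMate }

-- Closing the cylinder

cylinderTrade : ∀ {k h w} → suc k ≡ h + w → 0 < h → 0 < w → (R : Tiling h w) →
  Σ (TripleSet (suc k)) λ T → IsLatinTrade (B (suc k)) T × Nonempty T
    × ∣ T ∣ ≡ suc ∣ R ∣ₜ + suc ∣ R ∣ₜ
    × (∀ s → occurrences s T ≡ 2 ⊎ occurrences s T ≡ 0)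
cylinderTrade {k} {h} {w} p≡h+w 0<h 0<w R =
  T , T-isLatinTrade , (_ , here refl) , M.length-pairs Q , M.symbol-twice keyed
  where
  p = suc k
  -- Placed to the right of the rectangle, it completes a strip of width `w + h`, which is p, so
  -- that the two ends of the strip coincide modulo p. Its antidiagonal is p, above all others by
  -- `bounded`.
  closing : Square
  closing = ⟨ 0 , w , h ⟩
  Q = closing ∷ squares R

  h<p : h < p
  h<p = <-≤-trans (m<m+n h 0<w) (≤-reflexive (sym p≡h+w))

  antidiagonals : All (λ q → 0 < antidiagonal q × antidiagonal q < p) (squares R)
  antidiagonals = All.zipWith (λ {q} (0<d , q<) →
    ≤-trans 0<d (m≤n+m (side q) _) , <-≤-trans q< (≤-reflexive (sym p≡h+w))) (positive R , bounded R)

  closing≡p : antidiagonal closing ≡ p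
  closing≡p = trans (+-comm w h) (sym p≡h+w)

  small : All (λ q → 0 < side q × side q < p) Q
  small = (0<h , h<p) ∷ All.zipWith (λ {q} (0<d , _ , q<p) →
    0<d , ≤-<-trans (m≤n+m (side q) _) q<p) (positive R , antidiagonals)

  keyed : AllPairs (λ q r → antidiagonal q mod p ≢ antidiagonal r mod p) Q
  keyed = All.map (λ (0<q , q<p) → <-mod-≢ 0<q (<-≤-trans q<p (≤-reflexive (sym closing≡p))) (≤-reflexive closing≡p)) antidiagonals
        ∷ inner antidiagonals (distinct R)
    where
    inner : ∀ {qs} → All (λ q → 0 < antidiagonal q × antidiagonal q < p) qs → Distinct qs →
            AllPairs (λ q r → antidiagonal q mod p ≢ antidiagonal r mod p) qs
    inner [] [] = []
    inner ((0<q , q<p) ∷ rs) (q≢ ∷ qs) =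
      All.zipWith (λ ((0<r , r<p) , q≢r) eq → q≢r (mod-injective 0<q (<⇒≤ q<p) 0<r (<⇒≤ r<p) eq)) (rs , q≢)
      ∷ inner rs qs

  wraps : p mod p ≡ 0 mod p
  wraps = toℕ-injective (trans (toℕ-mod p) (n%n≡0 p))

  balanced′ : ∀ (f : Cell p → ℤ) → ∑ (squareSum (λ x y → f (x mod p , y mod p))) Q ≡ ℤ.0ℤ
  balanced′ f = begin
    cornerSum g 0 h w (w + h) ℤ.+ ∑ (squareSum g) (squares R)
      ≡⟨ cong (ℤ._+_ (cornerSum g 0 h w (w + h))) (balanced R g) ⟩
    cornerSum g 0 h w (w + h) ℤ.+ cornerSum g 0 h 0 w
      ≡⟨ ℤₚ.+-comm _ (cornerSum g 0 h 0 w) ⟩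
    cornerSum g 0 h 0 w ℤ.+ cornerSum g 0 h w (w + h)
      ≡⟨ cornerSum-beside g 0 h 0 w (w + h) ⟩
    cornerSum g 0 h 0 (w + h)
      ≡⟨ cong₂ (λ a b → g 0 0 ℤ.+ a ℤ.- (b ℤ.+ g h 0)) (around h) (around 0) ⟩
    g 0 0 ℤ.+ g h 0 ℤ.- (g 0 0 ℤ.+ g h 0)
      ≡⟨ ℤₚ.+-inverseʳ (g 0 0 ℤ.+ g h 0) ⟩
    ℤ.0ℤ ∎
    where
    open ≡-Reasoning
    g : ℕ → ℕ → ℤ
    g x y = f (x mod p , y mod p)
    around : ∀ x → g x (w + h) ≡ g x 0
    around x = cong (λ c → f (x mod p , c)) (trans (cong (_mod p) closing≡p) wraps)

  open Trade Q small keyed balanced′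

-- Tilings for primes and the final bound

domino : Tiling 1 2
domino = record
  { squares  = ⟨ 0 , 0 , 1 ⟩ ∷ ⟨ 0 , 1 , 1 ⟩ ∷ []
  ; balanced = λ f → trans (cong (ℤ._+_ (cornerSum f 0 1 0 1)) (ℤₚ.+-identityʳ (cornerSum f 0 1 1 2)))
      (cornerSum-beside f 0 1 0 1 2)
  ; positive = s≤s z≤n ∷ s≤s z≤n ∷ []
  ; bounded  = from-yes (1 <? 3) ∷ from-yes (2 <? 3) ∷ []
  ; distinct = ((λ ()) ∷ []) ∷ [] ∷ []
  }

ShortTiling : ℕ → Set
ShortTiling p = ∃[ h ] ∃[ w ] (p ≡ h + w × 0 < h × 0 < w × Σ (Tiling h w) Short)

odd-shortTiling : ∀ q → ShortTiling (3 + q * 2)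
-- For p = 3 the general shape would have height 0.
odd-shortTiling zero    = 1 , 2 , refl , s≤s z≤n , s≤s z≤n , domino , from-yes (2 ^ 2 ≤? 3 ^ 6)
odd-shortTiling (suc n) with record { breadth≡ = refl ; tiling = R ; short = short } ← tileable (suc n) (s≤s z≤n) =
  suc n , suc n + 3 , total n , s≤s z≤n , s≤s z≤n , R , short
  where
  total : ∀ n → 3 + (1 + n) * 2 ≡ 1 + n + (1 + n + 3)
  total = ℕ-Solver.solve-∀

prime-shortTiling : ∀ {p} → Prime p → ShortTiling p
prime-shortTiling {p} prime-p with p divMod 2
... | result q Fin.zero eq with prime⇒irreducible prime-p (divides q eq)
...   | inj₂ refl = 1 , 1 , refl , s≤s z≤n , s≤s z≤n , unit , from-yes (2 ^ 1 ≤? 2 ^ 6)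
prime-shortTiling prime-p | result zero (Fin.suc Fin.zero) refl = contradiction prime-p ¬prime[1]
prime-shortTiling prime-p | result (suc q) (Fin.suc Fin.zero) refl = odd-shortTiling q

theorem5p1 : ∃[ C ] (0 < C × (∀ (p : ℕ) → Prime p →
    ∃[ T ] (IsLatinTrade (B p) T × Nonempty T × ∣ T ∣ ≤ C ·log₂ p ×
    (∀ (s : Fin p) → occurrences s T ≡ 2 ⊎ occurrences s T ≡ 0))))
-- The constant is 2 · (6 + 1): two cells for each square, at most 6 log₂ p squares in the
-- rectangle, and 1 ≤ log₂ p for the closing one.
theorem5p1 = 14 , s≤s z≤n , λ p prime-p → trade (prime-shortTiling prime-p)
  where
  trade : ∀ {p} → ShortTiling p →
    ∃[ T ] (IsLatinTrade (B p) T × Nonempty T × ∣ T ∣ ≤ 14 ·log₂ p ×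
    (∀ (s : Fin p) → occurrences s T ≡ 2 ⊎ occurrences s T ≡ 0))
  -- Exposing `h` as a successor makes `h + w` one by computation, as `cylinderTrade` demands.
  trade (h@(suc _) , w , refl , 0<h , 0<w , R , short)
    with T , isTrade , nonempty , ∣T∣ , twice ← cylinderTrade refl 0<h 0<w R =
    T , isTrade , nonempty , bound , twice
    where
    open ≤-Reasoning
    p = h + w
    half : 2 ^ suc ∣ R ∣ₜ ≤ p ^ 7
    half = *-mono-≤ (+-mono-≤ 0<h 0<w) short
    bound : 2 ^ ∣ T ∣ ≤ p ^ 14
    bound = begin
      2 ^ ∣ T ∣                         ≡⟨ cong (2 ^_) ∣T∣ ⟩
      2 ^ (suc ∣ R ∣ₜ + suc ∣ R ∣ₜ)     ≡⟨ ^-distribˡ-+-* 2 (suc ∣ R ∣ₜ) (suc ∣ R ∣ₜ) ⟩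
      2 ^ suc ∣ R ∣ₜ * 2 ^ suc ∣ R ∣ₜ   ≤⟨ *-mono-≤ half half ⟩
      p ^ 7 * p ^ 7                     ≡⟨ ^-distribˡ-+-* p 7 7 ⟨
      p ^ 14                            ∎
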